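{- Let $G$ be a graph on $N\ge1$ vertices and let $m\in\mathbb{N}$. Then the moment matrix $\mathcal{M}_m$ of the adjacency matrix of $G$ in the state $\varphi_e$ is a graph invariant: if $A$ is an adjacency matrix of $G$ and $P$ is any $N\times N$ permutation matrix, then the moment matrix of degree $m$ of $PAP^\top$ equals the moment matrix of degree $m$ of $A$.
   Context: Graphs are finite, undirected, without loops (and simple). The adjacency matrix of a graph on vertices $\{1,\ldots,N\}$ is the $0/1$ matrix $A$ with $A_{ij}=1$ iff $\{i,j\}$ is an edge. A property of a graph is called a graph invariant if it does not change under reordering of the vertices, i.e. under replacing $A$ by $PAP^\top$ with $P$ a permutation matrix. Let $e=1_N/\|1_N\|_2\in\mathbb{C}^N$, where $1_N$ is the all-ones column vector, and $\varphi_e(B)=\langle e,Be\rangle$ for $B\in M_N$ (the complex $N\times N$ matrices). The moment matrix of degree $m$ of $A$ is the $(m+1)\times(m+1)$ matrix with $(i,j)$ entry $\varphi_e(A^{i+j})$, $0\le i,j\le m$. $\mathbb{N}=\{0,1,2,\ldots\}$. -}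

module Defs where

open import Algebra.Bundles using (CommutativeRing)
import Algebra.Properties.CommutativeMonoid.Sum as CommutativeMonoidSum
open import Algebra.Structures using (IsCommutativeRing)
open import Data.Bool.Base using (if_then_else_)
open import Data.Fin.Base using (Fin; toℕ)
open import Data.Fin.Permutation using (Permutation′; _⟨$⟩ʳ_)
import Data.Fin.Properties as Fin
import Data.Integer.Base as ℤ
import Data.Integer.Properties as ℤ
open import Data.Nat.Base as ℕ using (ℕ; zero; suc; NonZero)
import Data.Nat.Coprimality as Coprime
import Data.Nat.Properties as ℕ
open import Data.Product using (∃!)
open import Data.Product.Base using (∃; Σ-syntax; _×_; _,_; uncurry)
import Data.Rational.Base as ℚ
import Data.Rational.Properties as ℚ
open import Data.Rational.Solver using (module +-*-Solver)
import Data.Rational.Unnormalised.Base as ℚᵘ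
import Data.Rational.Unnormalised.Properties as ℚᵘ
open import Data.Sum.Base using (_⊎_; inj₁; inj₂)
open import Data.Vec.Functional using (Vector)
open import Function.Bundles using (_⇔_)
open import Level using (0ℓ)
open import Relation.Binary.Core using (Rel)
open import Relation.Binary.Definitions using (Decidable; Irreflexive; Symmetric)
open import Relation.Binary.PropositionalEquality as ≡ using (_≡_; _≢_)
open import Relation.Nullary.Decidable.Core using (Dec; does; yes; no)
open import Relation.Nullary.Negation.Core using (contradiction)

------------------------------------------------------------------------
-- The reals, as Cauchy sequences of rationals

module Reals where
  open ≡ using (refl; sym; trans; cong; cong₂; subst)
  open import Data.Rational.Base
  open ℚ.≤-Reasoning
  open +-*-Solver

  private
    0<1 : 0ℚ < 1ℚ
    0<1 = ℚ.positive⁻¹ 1ℚ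

    0<½ : 0ℚ < ½
    0<½ = ℚ.positive⁻¹ ½

    *-mono-≤ : ∀ {a b c d} → 0ℚ ≤ a → a ≤ b → 0ℚ ≤ c → c ≤ d → a * c ≤ b * d
    *-mono-≤ {a} {b} {c} {d} 0≤a a≤b 0≤c c≤d = begin
      a * c ≤⟨ ℚ.*-monoʳ-≤-nonNeg c {{nonNegative 0≤c}} a≤b ⟩
      b * c ≤⟨ ℚ.*-monoˡ-≤-nonNeg b {{nonNegative (ℚ.≤-trans 0≤a a≤b)}} c≤d ⟩
      b * d ∎

    *-nonNeg : ∀ {a b} → 0ℚ ≤ a → 0ℚ ≤ b → 0ℚ ≤ a * b
    *-nonNeg 0≤a 0≤b = *-mono-≤ {0ℚ} {_} {0ℚ} ℚ.≤-refl 0≤a ℚ.≤-refl 0≤b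

    *-pos : ∀ {a b} → 0ℚ < a → 0ℚ < b → 0ℚ < a * b
    *-pos {a} {b} 0<a 0<b = begin-strict
      0ℚ     ≡⟨ ℚ.*-zeroʳ a ⟨
      a * 0ℚ <⟨ ℚ.*-monoʳ-<-pos a {{positive 0<a}} 0<b ⟩
      a * b  ∎

    +-nonNeg : ∀ {a b} → 0ℚ ≤ a → 0ℚ ≤ b → 0ℚ ≤ a + b
    +-nonNeg 0≤a 0≤b = ℚ.+-mono-≤ {0ℚ} {_} {0ℚ} 0≤a 0≤b

    ½+½ : ∀ ε → ½ * ε + ½ * ε ≡ ε
    ½+½ ε = trans (sym (ℚ.*-distribʳ-+ ε ½ ½)) (ℚ.*-identityˡ ε)

    x-y<z⇒x<y+z : ∀ {x y z} → x - y < z → x < y + z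
    x-y<z⇒x<y+z {x} {y} {z} p = begin-strict
      x           ≡⟨ solve 2 (λ x y → x := y :+ (x :- y)) refl x y ⟩
      y + (x - y) <⟨ ℚ.+-monoʳ-< y p ⟩
      y + z       ∎

    x<y+z⇒x-y<z : ∀ {x y z} → x < y + z → x - y < z
    x<y+z⇒x-y<z {x} {y} {z} p = begin-strict
      x - y         <⟨ ℚ.+-monoˡ-< (- y) p ⟩
      y + z - y     ≡⟨ solve 2 (λ y z → y :+ z :- y := z) refl y z ⟩
      z             ∎

    p≤q⇒0≤q-p : ∀ {p q} → p ≤ q → 0ℚ ≤ q - p
    p≤q⇒0≤q-p {p} {q} p≤q = subst (_≤ q - p) (ℚ.+-inverseʳ p) (ℚ.+-monoˡ-≤ (- p) p≤q)

    p≤∣p∣ : ∀ p → p ≤ ∣ p ∣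
    p≤∣p∣ p with ℚ.≤-total 0ℚ p
    ... | inj₁ 0≤p = ℚ.≤-reflexive (sym (ℚ.0≤p⇒∣p∣≡p 0≤p))
    ... | inj₂ p≤0 = ℚ.≤-trans p≤0 (ℚ.0≤∣p∣ p)

    ∣p-q∣≡∣q-p∣ : ∀ p q → ∣ p - q ∣ ≡ ∣ q - p ∣
    ∣p-q∣≡∣q-p∣ p q = trans (sym (ℚ.∣-p∣≡∣p∣ (p - q)))
      (cong ∣_∣ (solve 2 (λ p q → :- (p :- q) := q :- p) refl p q))

    ∣x-y∣< : ∀ {x y z} → x - y < z → y - x < z → ∣ x - y ∣ < z
    ∣x-y∣< {x} {y} p q with ℚ.∣p∣≡p∨∣p∣≡-p (x - y)
    ... | inj₁ e = subst (_< _) (sym e) p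
    ... | inj₂ e = subst (_< _)
      (sym (trans e (solve 2 (λ p q → :- (p :- q) := q :- p) refl x y))) q

    recip : ∀ q → 0ℚ < q → ∃ λ r → 0ℚ < r × r * q ≡ 1ℚ
    recip q 0<q = 1/ q , ℚ.positive⁻¹ _ {{ℚ.1/pos⇒pos q}} , ℚ.*-inverseˡ q
      where instance
        _ = positive 0<q
        _ = ℚ.pos⇒nonZero q

    fromℕ : ℕ → ℚ
    fromℕ n = mkℚ (ℤ.+ n) 0 (Coprime.sym (Coprime.1-coprimeTo n))

    fromℕ-suc : ∀ n → fromℕ (suc n) ≡ 1ℚ + fromℕ n
    fromℕ-suc n = ℚ.toℚᵘ-injective (ℚᵘ.≃-trans
      (ℚᵘ.*≡* (cong (ℤ._* ℤ.1ℤ) (sym (trans (cong (λ z → ℤ.1ℤ ℤ.+ z) (ℤ.*-identityʳ (ℤ.+ n))) refl))))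
      (ℚᵘ.≃-sym (ℚ.toℚᵘ-homo-+ 1ℚ (fromℕ n))))

    archimedean : ∀ q → ∃ λ n → q ≤ fromℕ n
    archimedean (mkℚ n d-1 _) = ℤ.∣ n ∣ , *≤* (ℤ.≤-trans
      (ℤ.≤-reflexive (ℤ.*-identityʳ n)) (ℤ.≤-trans (lem n)
        (ℤ.≤-trans (ℤ.+≤+ (ℕ.m≤m*n ℤ.∣ n ∣ (suc d-1))) (ℤ.≤-reflexive (ℤ.pos-* ℤ.∣ n ∣ (suc d-1))))))
      where
      lem : ∀ i → i ℤ.≤ ℤ.+ ℤ.∣ i ∣
      lem (ℤ.+ k)    = ℤ.≤-refl
      lem ℤ.-[1+ k ] = ℤ.-≤+


  -- Null families of rationals
  --
  -- The index type is ℕ for the equality of reals and ℕ × ℕ for the Cauchy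
  -- condition; `rank` says how far out an index lies.

  private
    module Limits {I : Set} (rank : I → ℕ) where

      Eventually : (I → Set) → Set
      Eventually P = ∃ λ N → ∀ i → N ℕ.≤ rank i → P i

      record Null (u : I → ℚ) : Set where
        constructor mkNull
        field small : ∀ ε → 0ℚ < ε → Eventually λ i → ∣ u i ∣ < ε
      open Null public

      record Bounded (u : I → ℚ) : Set where
        constructor mkBounded
        field
          bound   : ℚ
          0<bound : 0ℚ < bound
          ≤bound  : Eventually λ i → ∣ u i ∣ ≤ bound

      always : ∀ {P} → (∀ i → P i) → Eventually P
      always p = 0 , λ i _ → p i

      map : ∀ {P Q} → (∀ i → P i → Q i) → Eventually P → Eventually Q
      map f (N , p) = N , λ i h → f i (p i h)

      zipWith : ∀ {P Q R} → (∀ i → P i → Q i → R i) → Eventually P → Eventually Q → Eventually R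
      zipWith f (M , p) (N , q) = M ℕ.⊔ N , λ i h →
        f i (p i (ℕ.m⊔n≤o⇒m≤o M N h)) (q i (ℕ.m⊔n≤o⇒n≤o M N h))

      null-cong : ∀ {u v} → Eventually (λ i → u i ≡ v i) → Null u → Null v
      small (null-cong u≡v nu) ε 0<ε = zipWith (λ i e → subst (λ z → ∣ z ∣ < ε) e) u≡v (small nu ε 0<ε)

      null-0 : ∀ {u} → Eventually (λ i → u i ≡ 0ℚ) → Null u
      small (null-0 e) ε 0<ε = map (λ i e → subst (λ z → ∣ z ∣ < ε) (sym e) 0<ε) e

      null-+ : ∀ {u v} → Null u → Null v → Null λ i → u i + v i
      small (null-+ {u} {v} nu nv) ε 0<ε = zipWith step (small nu (½ * ε) 0<½ε) (small nv (½ * ε) 0<½ε)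
        where
        0<½ε = *-pos 0<½ 0<ε
        step : ∀ i → ∣ u i ∣ < ½ * ε → ∣ v i ∣ < ½ * ε → ∣ u i + v i ∣ < ε
        step i p q = begin-strict
          ∣ u i + v i ∣     ≤⟨ ℚ.∣p+q∣≤∣p∣+∣q∣ (u i) (v i) ⟩
          ∣ u i ∣ + ∣ v i ∣ <⟨ ℚ.+-mono-< p q ⟩
          ½ * ε + ½ * ε     ≡⟨ ½+½ ε ⟩
          ε                 ∎

      null-neg : ∀ {u} → Null u → Null λ i → - u i
      small (null-neg {u} nu) ε 0<ε = map (λ i → subst (_< ε) (sym (ℚ.∣-p∣≡∣p∣ (u i)))) (small nu ε 0<ε)

      null-* : ∀ {u v} → Bounded u → Null v → Null λ i → u i * v i
      small (null-* {u} {v} (mkBounded K 0<K bu) nv) ε 0<ε with recip K 0<K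
      ... | r , 0<r , rK≡1 = zipWith step bu (small nv (r * ε) (*-pos 0<r 0<ε))
        where
        step : ∀ i → ∣ u i ∣ ≤ K → ∣ v i ∣ < r * ε → ∣ u i * v i ∣ < ε
        step i p q = begin-strict
          ∣ u i * v i ∣     ≡⟨ ℚ.∣p*q∣≡∣p∣*∣q∣ (u i) (v i) ⟩
          ∣ u i ∣ * ∣ v i ∣ ≤⟨ *-mono-≤ (ℚ.0≤∣p∣ (u i)) p (ℚ.0≤∣p∣ (v i)) ℚ.≤-refl ⟩
          K * ∣ v i ∣       <⟨ ℚ.*-monoʳ-<-pos K {{positive 0<K}} q ⟩
          K * (r * ε)       ≡⟨ solve 3 (λ K r ε → K :* (r :* ε) := (r :* K) :* ε) refl K r ε ⟩
          (r * K) * ε       ≡⟨ cong (_* ε) rK≡1 ⟩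
          1ℚ * ε            ≡⟨ ℚ.*-identityˡ ε ⟩
          ε                 ∎

      null-squeeze : ∀ {u v} → Eventually (λ i → 0ℚ ≤ u i) → Eventually (λ i → u i ≤ v i) → Null v → Null u
      small (null-squeeze {u} {v} 0≤u u≤v nv) ε 0<ε = zipWith (λ i f g → f g)
        (zipWith step 0≤u u≤v) (small nv ε 0<ε)
        where
        step : ∀ i → 0ℚ ≤ u i → u i ≤ v i → ∣ v i ∣ < ε → ∣ u i ∣ < ε
        step i 0≤ui ui≤vi vi<ε = begin-strict
          ∣ u i ∣ ≡⟨ ℚ.0≤p⇒∣p∣≡p 0≤ui ⟩
          u i     ≤⟨ ui≤vi ⟩
          v i     ≤⟨ p≤∣p∣ (v i) ⟩
          ∣ v i ∣ <⟨ vi<ε ⟩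
          ε       ∎

      bounded-* : ∀ {u v} → Bounded u → Bounded v → Bounded λ i → u i * v i
      bounded-* {u} {v} (mkBounded K 0<K bu) (mkBounded L 0<L bv) = mkBounded (K * L) (*-pos 0<K 0<L)
        (zipWith (λ i p q → subst (_≤ K * L) (sym (ℚ.∣p*q∣≡∣p∣*∣q∣ (u i) (v i)))
          (*-mono-≤ (ℚ.0≤∣p∣ (u i)) p (ℚ.0≤∣p∣ (v i)) q)) bu bv)

    module L₁ = Limits {ℕ} (λ n → n)
    module L₂ = Limits {ℕ × ℕ} (uncurry ℕ._⊓_)

  IsCauchy : (ℕ → ℚ) → Set
  IsCauchy x = ∀ ε → 0ℚ < ε → ∃ λ N → ∀ m n → N ℕ.≤ m → N ℕ.≤ n → ∣ x m - x n ∣ < ε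

  record ℝ : Set where
    constructor mkℝ
    no-eta-equality
    field
      seq    : ℕ → ℚ
      cauchy : IsCauchy seq
  open ℝ public

  infix 4 _≈ᴿ_
  record _≈ᴿ_ (x y : ℝ) : Set where
    constructor mk≈
    field
      converge : ∀ ε → 0ℚ < ε → ∃ λ N → ∀ n → N ℕ.≤ n → ∣ seq x n - seq y n ∣ < ε

  0≤ᴿ_ : ℝ → Set
  0≤ᴿ x = ∀ ε → 0ℚ < ε → ∃ λ N → ∀ n → N ℕ.≤ n → - ε < seq x n

  _#0 : ℝ → Set
  x #0 = ∃ λ δ → 0ℚ < δ × ∃ λ N → ∀ n → N ℕ.≤ n → δ ≤ ∣ seq x n ∣

  private abstract
    differences-null : ∀ x → L₂.Null λ (m , n) → seq x m - seq x n
    L₂.small (differences-null x) ε 0<ε with cauchy x ε 0<ε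
    ... | N , p = N , λ (m , n) h → p m n (ℕ.m≤n⊓o⇒m≤n m n h) (ℕ.m≤n⊓o⇒m≤o m n h)

    fromNull : ∀ x → L₂.Null (λ (m , n) → x m - x n) → IsCauchy x
    fromNull x c ε 0<ε with L₂.small c ε 0<ε
    ... | N , p = N , λ m n N≤m N≤n → p (m , n) (ℕ.⊓-glb N≤m N≤n)

    bounded : ∀ x → L₁.Bounded (seq x)
    bounded x with cauchy x 1ℚ 0<1
    ... | N , p = L₁.mkBounded (1ℚ + ∣ seq x N ∣) 0<K (N , λ n N≤n → ℚ.<⇒≤ (step n N≤n))
      where
      0<K : 0ℚ < 1ℚ + ∣ seq x N ∣
      0<K = ℚ.+-mono-<-≤ {0ℚ} {1ℚ} {0ℚ} 0<1 (ℚ.0≤∣p∣ (seq x N))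
      step : ∀ n → N ℕ.≤ n → ∣ seq x n ∣ < 1ℚ + ∣ seq x N ∣
      step n N≤n = begin-strict
        ∣ seq x n ∣                         ≡⟨ cong ∣_∣ (solve 2 (λ a b → a := a :- b :+ b) refl (seq x n) (seq x N)) ⟩
        ∣ seq x n - seq x N + seq x N ∣     ≤⟨ ℚ.∣p+q∣≤∣p∣+∣q∣ (seq x n - seq x N) (seq x N) ⟩
        ∣ seq x n - seq x N ∣ + ∣ seq x N ∣ <⟨ ℚ.+-monoˡ-< ∣ seq x N ∣ (p n N N≤n ℕ.≤-refl) ⟩
        1ℚ + ∣ seq x N ∣                    ∎

    left : ∀ {u : ℕ → ℚ} → L₁.Bounded u → L₂.Bounded λ (m , n) → u m
    left (L₁.mkBounded K 0<K (N , p)) = L₂.mkBounded K 0<K (N , λ (m , n) h → p m (ℕ.m≤n⊓o⇒m≤n m n h))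

    right : ∀ {u : ℕ → ℚ} → L₁.Bounded u → L₂.Bounded λ (m , n) → u n
    right (L₁.mkBounded K 0<K (N , p)) = L₂.mkBounded K 0<K (N , λ (m , n) h → p n (ℕ.m≤n⊓o⇒m≤o m n h))

    const-cauchy : ∀ q → IsCauchy λ _ → q
    const-cauchy q = fromNull (λ _ → q) (L₂.null-0 (L₂.always λ _ → ℚ.+-inverseʳ q))

    +-cauchy : ∀ x y → IsCauchy λ n → seq x n + seq y n
    +-cauchy x y = fromNull (λ n → seq x n + seq y n) (L₂.null-cong
      (L₂.always λ (m , n) → solve 4 (λ a b c d → (a :- b) :+ (c :- d) := (a :+ c) :- (b :+ d))
        refl (seq x m) (seq x n) (seq y m) (seq y n))
      (L₂.null-+ (differences-null x) (differences-null y)))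

    neg-cauchy : ∀ x → IsCauchy λ n → - seq x n
    neg-cauchy x = fromNull (λ n → - seq x n) (L₂.null-cong
      (L₂.always λ (m , n) → solve 2 (λ a b → :- (a :- b) := (:- a) :- (:- b))
        refl (seq x m) (seq x n))
      (L₂.null-neg (differences-null x)))

    *-cauchy : ∀ x y → IsCauchy λ n → seq x n * seq y n
    *-cauchy x y = fromNull (λ n → seq x n * seq y n) (L₂.null-cong
      (L₂.always λ (m , n) → solve 4 (λ a b c d → a :* (c :- d) :+ d :* (a :- b) := a :* c :- b :* d)
        refl (seq x m) (seq x n) (seq y m) (seq y n))
      (L₂.null-+ (L₂.null-* (left (bounded x)) (differences-null y))
                 (L₂.null-* (right (bounded y)) (differences-null x))))

  fromℚ : ℚ → ℝ
  fromℚ q = mkℝ (λ _ → q) (const-cauchy q)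

  0ᴿ 1ᴿ : ℝ
  0ᴿ = fromℚ 0ℚ
  1ᴿ = fromℚ 1ℚ

  infixl 6 _+ᴿ_
  infixl 7 _*ᴿ_
  infix  8 -ᴿ_

  _+ᴿ_ _*ᴿ_ : ℝ → ℝ → ℝ
  x +ᴿ y = mkℝ (λ n → seq x n + seq y n) (+-cauchy x y)
  x *ᴿ y = mkℝ (λ n → seq x n * seq y n) (*-cauchy x y)

  -ᴿ_ : ℝ → ℝ
  -ᴿ x = mkℝ (λ n → - seq x n) (neg-cauchy x)

  private abstract
    toNull₁ : ∀ {x y} → x ≈ᴿ y → L₁.Null λ n → seq x n - seq y n
    toNull₁ (mk≈ p) = L₁.mkNull p

    fromNull₁ : ∀ {x y} → L₁.Null (λ n → seq x n - seq y n) → x ≈ᴿ y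
    fromNull₁ p = mk≈ (L₁.small p)

    pointwise : ∀ {x y} → (∀ n → seq x n ≡ seq y n) → x ≈ᴿ y
    pointwise {x} {y} e = fromNull₁ (L₁.null-0 (L₁.always λ n →
      trans (cong (_- seq y n) (e n)) (ℚ.+-inverseʳ (seq y n))))

    ≈ᴿ-sym : ∀ {x y} → x ≈ᴿ y → y ≈ᴿ x
    ≈ᴿ-sym {x} {y} p = fromNull₁ (L₁.null-cong (L₁.always λ n → solve 2 (λ a b →
      :- (a :- b) := b :- a) refl (seq x n) (seq y n)) (L₁.null-neg (toNull₁ p)))

    ≈ᴿ-trans : ∀ {x y z} → x ≈ᴿ y → y ≈ᴿ z → x ≈ᴿ z
    ≈ᴿ-trans {x} {y} {z} p q = fromNull₁ (L₁.null-cong (L₁.always λ n → solve 3 (λ a b c →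
      (a :- b) :+ (b :- c) := a :- c) refl (seq x n) (seq y n) (seq z n)) (L₁.null-+ (toNull₁ p) (toNull₁ q)))

    +ᴿ-cong : ∀ {x x′ y y′} → x ≈ᴿ x′ → y ≈ᴿ y′ → x +ᴿ y ≈ᴿ x′ +ᴿ y′
    +ᴿ-cong {x} {x′} {y} {y′} p q = fromNull₁ (L₁.null-cong (L₁.always λ n →
      solve 4 (λ a b c d → (a :- b) :+ (c :- d) := (a :+ c) :- (b :+ d)) refl (seq x n) (seq x′ n) (seq y n) (seq y′ n)) (L₁.null-+ (toNull₁ p) (toNull₁ q)))

    -ᴿ-cong : ∀ {x y} → x ≈ᴿ y → -ᴿ x ≈ᴿ -ᴿ y
    -ᴿ-cong {x} {y} p = fromNull₁ (L₁.null-cong (L₁.always λ n → solve 2 (λ a b →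
      :- (a :- b) := (:- a) :- (:- b)) refl (seq x n) (seq y n)) (L₁.null-neg (toNull₁ p)))

    *ᴿ-cong : ∀ {x x′ y y′} → x ≈ᴿ x′ → y ≈ᴿ y′ → x *ᴿ y ≈ᴿ x′ *ᴿ y′
    *ᴿ-cong {x} {x′} {y} {y′} p q = fromNull₁ (L₁.null-cong (L₁.always λ n →
      solve 4 (λ a b c d → a :* (c :- d) :+ d :* (a :- b) := a :* c :- b :* d) refl (seq x n) (seq x′ n) (seq y n) (seq y′ n))
      (L₁.null-+ (L₁.null-* (bounded x) (toNull₁ q)) (L₁.null-* (bounded y′) (toNull₁ p))))

  ℝ-isCommutativeRing : IsCommutativeRing _≈ᴿ_ _+ᴿ_ _*ᴿ_ -ᴿ_ 0ᴿ 1ᴿ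
  ℝ-isCommutativeRing = record
    { isRing = record
      { +-isAbelianGroup = record
        { isGroup = record
          { isMonoid = record
            { isSemigroup = record
              { isMagma = record
                { isEquivalence = record
                  { refl  = pointwise λ _ → refl
                  ; sym   = ≈ᴿ-sym
                  ; trans = ≈ᴿ-trans
                  }
                ; ∙-cong = +ᴿ-cong
                }
              ; assoc = λ x y z → pointwise λ n → ℚ.+-assoc (seq x n) (seq y n) (seq z n)
              }
            ; identity = (λ x → pointwise λ n → ℚ.+-identityˡ (seq x n))
                       , (λ x → pointwise λ n → ℚ.+-identityʳ (seq x n))
            }
          ; inverse = (λ x → pointwise λ n → ℚ.+-inverseˡ (seq x n))
                    , (λ x → pointwise λ n → ℚ.+-inverseʳ (seq x n))
          ; ⁻¹-cong = -ᴿ-cong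
          }
        ; comm = λ x y → pointwise λ n → ℚ.+-comm (seq x n) (seq y n)
        }
      ; *-cong = *ᴿ-cong
      ; *-assoc = λ x y z → pointwise λ n → ℚ.*-assoc (seq x n) (seq y n) (seq z n)
      ; *-identity = (λ x → pointwise λ n → ℚ.*-identityˡ (seq x n))
                   , (λ x → pointwise λ n → ℚ.*-identityʳ (seq x n))
      ; distrib = (λ x y z → pointwise λ n → ℚ.*-distribˡ-+ (seq x n) (seq y n) (seq z n))
                , (λ x y z → pointwise λ n → ℚ.*-distribʳ-+ (seq x n) (seq y n) (seq z n))
      }
    ; *-comm = λ x y → pointwise λ n → ℚ.*-comm (seq x n) (seq y n)
    }

  -- The sequence is inverted termwise; its (finitely many, if x #0)
  -- zero terms are left at 0.
  private
    1/₀_ : ℚ → ℚ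
    1/₀ q with q ℚ.≟ 0ℚ
    ... | yes _  = 0ℚ
    ... | no q≢0 = (1/ q) {{≢-nonZero q≢0}}

    abstract
      1/₀-inverse : ∀ {q} → q ≢ 0ℚ → 1/₀ q * q ≡ 1ℚ
      1/₀-inverse {q} q≢0 with q ℚ.≟ 0ℚ
      ... | yes q≡0 = contradiction q≡0 q≢0
      ... | no q≢0 = ℚ.*-inverseˡ q {{≢-nonZero q≢0}}

      away : ∀ {δ q} → 0ℚ < δ → δ ≤ ∣ q ∣ → q ≢ 0ℚ
      away 0<δ δ≤∣q∣ refl = ℚ.<-irrefl refl (ℚ.<-≤-trans 0<δ δ≤∣q∣)

      1/₀-bounded : ∀ {u : ℕ → ℚ} → (∃ λ δ → 0ℚ < δ × L₁.Eventually λ n → δ ≤ ∣ u n ∣) → L₁.Bounded λ n → 1/₀ u n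
      1/₀-bounded {u} (δ , 0<δ , ev) with recip δ 0<δ
      ... | r , 0<r , rδ≡1 = L₁.mkBounded r 0<r (L₁.map step ev)
        where
        step : ∀ n → δ ≤ ∣ u n ∣ → ∣ 1/₀ u n ∣ ≤ r
        step n δ≤ = let v = 1/₀ u n in begin
          ∣ v ∣                   ≡⟨ ℚ.*-identityʳ _ ⟨
          ∣ v ∣ * 1ℚ              ≡⟨ cong (∣ v ∣ *_) rδ≡1 ⟨
          ∣ v ∣ * (r * δ)         ≤⟨ *-mono-≤ (ℚ.0≤∣p∣ v) ℚ.≤-refl (*-nonNeg (ℚ.<⇒≤ 0<r) (ℚ.<⇒≤ 0<δ))
                                      (*-mono-≤ (ℚ.<⇒≤ 0<r) ℚ.≤-refl (ℚ.<⇒≤ 0<δ) δ≤) ⟩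
          ∣ v ∣ * (r * ∣ u n ∣)   ≡⟨ solve 3 (λ a b c → a :* (b :* c) := b :* (a :* c)) refl (∣ v ∣) r (∣ u n ∣) ⟩
          r * (∣ v ∣ * ∣ u n ∣)   ≡⟨ cong (r *_) (sym (ℚ.∣p*q∣≡∣p∣*∣q∣ v (u n))) ⟩
          r * ∣ v * u n ∣         ≡⟨ cong (λ z → r * ∣ z ∣) (1/₀-inverse (away 0<δ δ≤)) ⟩
          r * 1ℚ                  ≡⟨ ℚ.*-identityʳ r ⟩
          r                       ∎

      1/₀-cauchy : ∀ x → x #0 → IsCauchy λ n → 1/₀ seq x n
      1/₀-cauchy x (δ , 0<δ , N , ev) = fromNull (λ n → 1/₀ seq x n) (L₂.null-cong (N , eq)
        (L₂.null-* (L₂.bounded-* (left b) (right b)) (L₂.null-neg (differences-null x))))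
        where
        b : L₁.Bounded λ n → 1/₀ seq x n
        b = 1/₀-bounded {seq x} (δ , 0<δ , N , ev)
        eq : ∀ ((m , n) : ℕ × ℕ) → N ℕ.≤ m ℕ.⊓ n →
             (1/₀ seq x m * 1/₀ seq x n) * - (seq x m - seq x n) ≡ 1/₀ seq x m - 1/₀ seq x n
        eq (m , n) h = let a = seq x m; b = seq x n; a′ = 1/₀ a; b′ = 1/₀ b in begin-equality
          (a′ * b′) * - (a - b)         ≡⟨ solve 4 (λ a b a′ b′ → (a′ :* b′) :* (:- (a :- b)) := a′ :* (b′ :* b) :- b′ :* (a′ :* a))
                                              refl a b a′ b′ ⟩
          a′ * (b′ * b) - b′ * (a′ * a) ≡⟨ cong₂ (λ s t → a′ * s - b′ * t)
                                              (1/₀-inverse (away 0<δ (ev n (ℕ.m≤n⊓o⇒m≤o m n h))))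
                                              (1/₀-inverse (away 0<δ (ev m (ℕ.m≤n⊓o⇒m≤n m n h)))) ⟩
          a′ * 1ℚ - b′ * 1ℚ             ≡⟨ cong₂ _-_ (ℚ.*-identityʳ a′) (ℚ.*-identityʳ b′) ⟩
          a′ - b′                       ∎

  inv : (x : ℝ) → x #0 → ℝ
  inv x x#0 = mkℝ (λ n → 1/₀ seq x n) (1/₀-cauchy x x#0)

  abstract
    inv-inverseˡ : ∀ x (x#0 : x #0) → inv x x#0 *ᴿ x ≈ᴿ 1ᴿ
    inv-inverseˡ x (δ , 0<δ , N , ev) = fromNull₁ (L₁.null-0 (N , λ n h →
      trans (cong (_- 1ℚ) (1/₀-inverse (away 0<δ (ev n h)))) (ℚ.+-inverseʳ 1ℚ)))

  -- n steps of bisection for the square root of q ≥ 0, starting from the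
  -- interval [0, q + 1] and keeping the left endpoint.
  private
    width : ℚ → ℕ → ℚ
    width q zero    = q + 1ℚ
    width q (suc n) = ½ * width q n

    bisect : ℚ → ℕ → ℚ
    bisect q zero    = 0ℚ
    bisect q (suc n) = let t = bisect q n + width q (suc n) in
      if does (t * t ℚ.≤? q) then t else bisect q n

    record Bisected (q s w : ℚ) : Set where
      field
        0≤s  : 0ℚ ≤ s
        0<w  : 0ℚ < w
        s²≤q : s * s ≤ q
        q<   : q < (s + w) * (s + w)

    abstract
      bisected : ∀ {q} → 0ℚ ≤ q → ∀ n → Bisected q (bisect q n) (width q n)
      bisected {q} 0≤q zero = record
        { 0≤s = ℚ.≤-refl ; 0<w = ℚ.+-mono-≤-< {0ℚ} {q} {0ℚ} 0≤q 0<1 ; s²≤q = 0≤q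
        ; q< = begin-strict
            q                     ≡⟨ ℚ.+-identityʳ q ⟨
            q + 0ℚ                <⟨ ℚ.+-monoʳ-< q (ℚ.+-mono-≤-< {0ℚ} {q * q + q} {0ℚ} (+-nonNeg (*-nonNeg 0≤q 0≤q) 0≤q) 0<1) ⟩
            q + (q * q + q + 1ℚ)  ≡⟨ solve 1 (λ q → q :+ (q :* q :+ q :+ con 1ℚ) :=
                                       (con 0ℚ :+ (q :+ con 1ℚ)) :* (con 0ℚ :+ (q :+ con 1ℚ))) refl q ⟩
            (0ℚ + (q + 1ℚ)) * (0ℚ + (q + 1ℚ)) ∎
        }
      bisected {q} 0≤q (suc n) = step (t * t ℚ.≤? q)
        where
        open Bisected (bisected 0≤q n)
        t : ℚ
        t = bisect q n + width q (suc n)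
        0<w′ : 0ℚ < width q (suc n)
        0<w′ = *-pos {½} {width q n} 0<½ 0<w
        step : (d : Dec (t * t ≤ q)) →
               Bisected q (if does d then t else bisect q n) (width q (suc n))
        step (yes t²≤q) = record
          { 0≤s  = +-nonNeg {bisect q n} {width q (suc n)} 0≤s (ℚ.<⇒≤ 0<w′)
          ; 0<w  = 0<w′
          ; s²≤q = t²≤q
          ; q<   = subst (λ z → q < z * z)
              (trans (cong (bisect q n +_) (sym (½+½ (width q n))))
                     (sym (ℚ.+-assoc (bisect q n) (width q (suc n)) (width q (suc n))))) q<
          }
        step (no t²≰q) = record
          { 0≤s = 0≤s ; 0<w = 0<w′ ; s²≤q = s²≤q ; q< = ℚ.≰⇒> t²≰q }

      -- left endpoints are close when the radicands are
      close : ∀ {p q a b w ε} → 0ℚ ≤ b → 0ℚ < w → 0ℚ < ε → a * a ≤ p → q < (b + w) * (b + w) →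
              p - q < ε * ε → a - b < w + ε
      close {p} {q} {a} {b} {w} {ε} 0≤b 0<w 0<ε a²≤p q< p-q< = x<y+z⇒x-y<z {a} {b} (ℚ.≰⇒> λ far →
        ℚ.<-irrefl refl (begin-strict
          p                             <⟨ x-y<z⇒x<y+z {p} {q} p-q< ⟩
          q + ε * ε                     <⟨ ℚ.+-monoˡ-< (ε * ε) q< ⟩
          (b + w) * (b + w) + ε * ε     ≡⟨ ℚ.+-identityʳ _ ⟨
          (b + w) * (b + w) + ε * ε + 0ℚ
            ≤⟨ ℚ.+-monoʳ-≤ ((b + w) * (b + w) + ε * ε) (+-nonNeg 0≤uε 0≤uε) ⟩
          (b + w) * (b + w) + ε * ε + ((b + w) * ε + (b + w) * ε)
            ≡⟨ solve 3 (λ b w ε → (b :+ w) :* (b :+ w) :+ ε :* ε :+ ((b :+ w) :* ε :+ (b :+ w) :* ε)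
                         := (b :+ (w :+ ε)) :* (b :+ (w :+ ε))) refl b w ε ⟩
          (b + (w + ε)) * (b + (w + ε)) ≤⟨ *-mono-≤ 0≤s far 0≤s far ⟩
          a * a                         ≤⟨ a²≤p ⟩
          p                             ∎))
        where
        0≤uε : 0ℚ ≤ (b + w) * ε
        0≤uε = *-nonNeg {b + w} (+-nonNeg {b} 0≤b (ℚ.<⇒≤ 0<w)) (ℚ.<⇒≤ 0<ε)
        0≤s : 0ℚ ≤ b + (w + ε)
        0≤s = +-nonNeg {b} {w + ε} 0≤b (+-nonNeg {w} (ℚ.<⇒≤ 0<w) (ℚ.<⇒≤ 0<ε))

      n*½ⁿ : ∀ q → 0ℚ ≤ q → ∀ n → width q n * fromℕ n ≤ q + 1ℚ
      n*½ⁿ q 0≤q n = ℚ.≤-trans (ℚ.≤-trans (ℚ.≤-reflexive (sym (ℚ.+-identityʳ _)))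
        (ℚ.+-monoʳ-≤ (width q n * fromℕ n) (ℚ.<⇒≤ (Bisected.0<w (bisected 0≤q n))))) (go n)
        where
        w≤ : ∀ n → width q n ≤ q + 1ℚ
        w≤ zero    = ℚ.≤-refl
        w≤ (suc n) = begin
          ½ * width q n                 ≡⟨ ℚ.+-identityʳ _ ⟨
          ½ * width q n + 0ℚ            ≤⟨ ℚ.+-monoʳ-≤ (½ * width q n) (ℚ.<⇒≤ (Bisected.0<w (bisected 0≤q (suc n)))) ⟩
          ½ * width q n + ½ * width q n ≡⟨ ½+½ (width q n) ⟩
          width q n                     ≤⟨ w≤ n ⟩
          q + 1ℚ                        ∎
        go : ∀ n → width q n * fromℕ n + width q n ≤ q + 1ℚ
        go zero    = ℚ.≤-reflexive (trans (cong (_+ (q + 1ℚ)) (ℚ.*-zeroʳ (q + 1ℚ))) (ℚ.+-identityˡ (q + 1ℚ)))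
        go (suc n) = let w = width q n in begin
          ½ * w * fromℕ (suc n) + ½ * w          ≡⟨ cong (λ z → ½ * w * z + ½ * w) (fromℕ-suc n) ⟩
          ½ * w * (1ℚ + fromℕ n) + ½ * w         ≡⟨ solve 3 (λ h w k → h :* w :* (con 1ℚ :+ k) :+ h :* w
                                                      := h :* (w :* k :+ w) :+ h :* w) refl ½ w (fromℕ n) ⟩
          ½ * (w * fromℕ n + w) + ½ * w          ≤⟨ ℚ.+-mono-≤ (ℚ.*-monoˡ-≤-nonNeg ½ (go n)) (ℚ.*-monoˡ-≤-nonNeg ½ (w≤ n)) ⟩
          ½ * (q + 1ℚ) + ½ * (q + 1ℚ)            ≡⟨ ½+½ (q + 1ℚ) ⟩
          q + 1ℚ                                 ∎

      -- widths tend to 0 uniformly in bounded radicands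
      width-null : ∀ {u : ℕ → ℚ} {K} → (∀ n → 0ℚ ≤ u n) → 0ℚ < K → L₁.Eventually (λ n → u n ≤ K) →
                   ∀ ε → 0ℚ < ε → L₁.Eventually λ n → width (u n) n < ε
      width-null {u} {K} 0≤u 0<K (M , bu) ε 0<ε with recip ε 0<ε
      ... | r , 0<r , rε≡1 with archimedean (r * (K + 1ℚ))
      ...   | N , r[K+1]≤N = M ℕ.⊔ suc N , λ n h →
        step n (bu n (ℕ.m⊔n≤o⇒m≤o M (suc N) h)) (ℕ.m⊔n≤o⇒n≤o M (suc N) h)
        where
        step : ∀ n → u n ≤ K → suc N ℕ.≤ n → width (u n) n < ε
        step n un≤K N<n = ℚ.≰⇒> λ ε≤w → ℚ.<-irrefl refl (begin-strict
          K + 1ℚ                   ≡⟨ ℚ.*-identityˡ _ ⟨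
          1ℚ * (K + 1ℚ)            ≡⟨ cong (_* (K + 1ℚ)) rε≡1 ⟨
          r * ε * (K + 1ℚ)         ≡⟨ solve 3 (λ r e k → r :* e :* k := e :* (r :* k)) refl r ε (K + 1ℚ) ⟩
          ε * (r * (K + 1ℚ))       <⟨ ℚ.*-monoʳ-<-pos ε {{positive 0<ε}} (ℚ.≤-<-trans r[K+1]≤N N<n′) ⟩
          ε * fromℕ n              ≤⟨ ℚ.*-monoʳ-≤-nonNeg (fromℕ n) ε≤w ⟩
          width (u n) n * fromℕ n  ≤⟨ n*½ⁿ (u n) (0≤u n) n ⟩
          u n + 1ℚ                 ≤⟨ ℚ.+-monoˡ-≤ 1ℚ un≤K ⟩
          K + 1ℚ                   ∎)
          where
          N<n′ : fromℕ N < fromℕ n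
          N<n′ = *<* (ℤ.*-monoʳ-<-pos ℤ.1ℤ (ℤ.+<+ N<n))

      clamp : ∀ p q {ε} → 0ℚ < ε → p - q < ε → (p ⊔ 0ℚ) - (q ⊔ 0ℚ) < ε
      clamp p q {ε} 0<ε p-q<ε = x<y+z⇒x-y<z {p ⊔ 0ℚ} {q ⊔ 0ℚ} lem
        where
        lem : p ⊔ 0ℚ < (q ⊔ 0ℚ) + ε
        lem with ℚ.⊔-sel p 0ℚ
        ... | inj₁ e = subst (_< (q ⊔ 0ℚ) + ε) (sym e)
          (ℚ.<-≤-trans (x-y<z⇒x<y+z {p} {q} p-q<ε) (ℚ.+-monoˡ-≤ ε (ℚ.p≤p⊔q q 0ℚ)))
        ... | inj₂ e = subst (_< (q ⊔ 0ℚ) + ε) (sym e)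
          (ℚ.+-mono-≤-< {0ℚ} {q ⊔ 0ℚ} {0ℚ} {ε} (ℚ.p≤q⊔p q 0ℚ) 0<ε)

      close′ : ∀ {p q a b v w ε} → Bisected p a v → Bisected q b w → 0ℚ < ε →
               p - q < (½ * ε) * (½ * ε) → w < ½ * ε → a - b < ε
      close′ {p} {q} {a} {b} {v} {w} {ε} A B 0<ε p-q< w< = ℚ.<-trans {a - b} {w + ½ * ε} {ε}
        (close {p} {q} {a} {b} {w} {½ * ε} (0≤s B) (0<w B) (*-pos 0<½ 0<ε) (s²≤q A) (q< B) p-q<)
        (subst (w + ½ * ε <_) (½+½ ε) (ℚ.+-monoˡ-< (½ * ε) w<))
        where open Bisected

    clamped : ℝ → ℕ → ℚ
    clamped x n = seq x n ⊔ 0ℚ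

    abstract
      √-bisected : ∀ x n → Bisected (clamped x n) (bisect (clamped x n) n) (width (clamped x n) n)
      √-bisected x n = bisected {clamped x n} (ℚ.p≤q⊔p (seq x n) 0ℚ) n

      clamped-≤ : ∀ q K → 0ℚ < K → ∣ q ∣ ≤ K → q ⊔ 0ℚ ≤ K
      clamped-≤ q K 0<K q≤K with ℚ.⊔-sel q 0ℚ
      ... | inj₁ e = subst (_≤ K) (sym e) (ℚ.≤-trans (p≤∣p∣ q) q≤K)
      ... | inj₂ e = subst (_≤ K) (sym e) (ℚ.<⇒≤ 0<K)

      0≤clamped : ∀ x n → 0ℚ ≤ clamped x n
      0≤clamped x n = ℚ.p≤q⊔p (seq x n) 0ℚ

      clamped-width : ∀ x ε → 0ℚ < ε → L₁.Eventually λ n → width (clamped x n) n < ε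
      clamped-width x = go (bounded x)
        where
        go : L₁.Bounded (seq x) → ∀ ε → 0ℚ < ε → L₁.Eventually λ n → width (clamped x n) n < ε
        go (L₁.mkBounded K 0<K (N , b)) = width-null {clamped x} {K} (0≤clamped x) 0<K
          (N , λ n h → clamped-≤ (seq x n) K 0<K (b n h))

      √-cauchy : ∀ x → IsCauchy λ n → bisect (clamped x n) n
      √-cauchy x ε 0<ε = merge (clamped-width x η 0<η) (cauchy x (η * η) (*-pos {η} {η} 0<η 0<η))
        where
        η : ℚ
        η = ½ * ε
        0<η : 0ℚ < η
        0<η = *-pos {½} {ε} 0<½ 0<ε
        s : ℕ → ℚ
        s n = bisect (clamped x n) n
        half : ∀ m n → ∣ seq x m - seq x n ∣ < η * η → width (clamped x n) n < η → s m - s n < ε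
        half m n d w = close′ {clamped x m} {clamped x n} {s m} {s n} (√-bisected x m) (√-bisected x n) 0<ε
          (clamp (seq x m) (seq x n) (*-pos {η} {η} 0<η 0<η)
            (ℚ.≤-<-trans (p≤∣p∣ (seq x m - seq x n)) d)) w
        merge : L₁.Eventually (λ n → width (clamped x n) n < η) →
                (∃ λ N → ∀ m n → N ℕ.≤ m → N ℕ.≤ n → ∣ seq x m - seq x n ∣ < η * η) →
                ∃ λ N → ∀ m n → N ℕ.≤ m → N ℕ.≤ n → ∣ s m - s n ∣ < ε
        merge (M , w) (N , d) = M ℕ.⊔ N , λ m n h k → ∣x-y∣< {s m} {s n}
          (half m n (d m n (ℕ.m⊔n≤o⇒n≤o M N h) (ℕ.m⊔n≤o⇒n≤o M N k)) (w n (ℕ.m⊔n≤o⇒m≤o M N k)))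
          (half n m (d n m (ℕ.m⊔n≤o⇒n≤o M N k) (ℕ.m⊔n≤o⇒n≤o M N h)) (w m (ℕ.m⊔n≤o⇒m≤o M N h)))

  -- √ x is the square root of max(x, 0).
  √_ : ℝ → ℝ
  √ x = mkℝ (λ n → bisect (clamped x n) n) (√-cauchy x)

  abstract
    0≤√ : ∀ x → 0≤ᴿ (√ x)
    0≤√ x ε 0<ε = 0 , λ n _ → ℚ.<-≤-trans (ℚ.neg-antimono-< 0<ε) (Bisected.0≤s (√-bisected x n))

    √-square : ∀ x → 0≤ᴿ x → √ x *ᴿ √ x ≈ᴿ x
    √-square x 0≤x = fromNull₁ (L₁.null-cong
      (L₁.always λ n → solve 3 (λ s c x → (:- (c :- s :* s)) :+ (c :- x) := s :* s :- x) refl (s n) (c n) (seq x n))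
      (L₁.null-+ (L₁.null-neg c-s²) c-x))
      where
      s c w : ℕ → ℚ
      s n = seq (√ x) n
      c n = clamped x n
      w n = width (c n) n

      w-null : L₁.Null w
      w-null = L₁.mkNull λ ε 0<ε → L₁.map
        (λ n → subst (_< ε) (sym (ℚ.0≤p⇒∣p∣≡p (ℚ.<⇒≤ (Bisected.0<w (√-bisected x n))))))
        (clamped-width x ε 0<ε)

      w-bounded : L₁.Bounded w
      w-bounded = L₁.mkBounded 1ℚ 0<1 (L₁.map (λ _ → ℚ.<⇒≤) (L₁.small w-null 1ℚ 0<1))

      c-s² : L₁.Null λ n → c n - s n * s n
      c-s² = L₁.null-squeeze
        (L₁.always λ n → p≤q⇒0≤q-p (Bisected.s²≤q (√-bisected x n)))
        (L₁.always upper)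
        (L₁.null-+ (L₁.null-+ (L₁.null-* (bounded (√ x)) w-null) (L₁.null-* (bounded (√ x)) w-null))
                   (L₁.null-* w-bounded w-null))
        where
        upper : ∀ n → c n - s n * s n ≤ s n * w n + s n * w n + w n * w n
        upper n = ℚ.<⇒≤ (x<y+z⇒x-y<z {c n} {s n * s n} (begin-strict
          c n                       <⟨ Bisected.q< (√-bisected x n) ⟩
          (s n + w n) * (s n + w n) ≡⟨ solve 2 (λ s w → (s :+ w) :* (s :+ w) :=
                                         s :* s :+ (s :* w :+ s :* w :+ w :* w)) refl (s n) (w n) ⟩
          s n * s n + (s n * w n + s n * w n + w n * w n) ∎))

      c-x : L₁.Null λ n → c n - seq x n
      c-x = L₁.mkNull λ ε 0<ε → L₁.map (λ n → near n ε 0<ε) (0≤x ε 0<ε)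
        where
        near : ∀ n ε → 0ℚ < ε → - ε < seq x n → ∣ c n - seq x n ∣ < ε
        near n ε 0<ε -ε<x with ℚ.⊔-sel (seq x n) 0ℚ
        ... | inj₁ e = subst (λ z → ∣ z - seq x n ∣ < ε) (sym e)
          (subst (λ z → ∣ z ∣ < ε) (sym (ℚ.+-inverseʳ (seq x n))) 0<ε)
        ... | inj₂ e = begin-strict
          ∣ c n - seq x n ∣ ≡⟨ ℚ.0≤p⇒∣p∣≡p (p≤q⇒0≤q-p (ℚ.p≤p⊔q (seq x n) 0ℚ)) ⟩
          c n - seq x n     ≡⟨ cong (_- seq x n) e ⟩
          0ℚ - seq x n      ≡⟨ ℚ.+-identityˡ (- seq x n) ⟩
          - seq x n         <⟨ ℚ.neg-antimono-< -ε<x ⟩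
          - (- ε)           ≡⟨ solve 1 (λ e → :- (:- e) := e) refl ε ⟩
          ε                 ∎

    √-apart : ∀ x → (∀ n → 1ℚ ≤ seq x n) → (√ x) #0
    √-apart x 1≤x = ½ , 0<½ , L₁.map step (clamped-width x ½ 0<½)
      where
      step : ∀ n → width (clamped x n) n < ½ → ½ ≤ ∣ seq (√ x) n ∣
      step n w<½ = ℚ.≤-trans (ℚ.≮⇒≥ λ s<½ → ℚ.<-irrefl refl (begin-strict
        clamped x n       <⟨ q< ⟩
        (s + w) * (s + w) ≤⟨ *-mono-≤ 0≤s+w (s+w≤1 s<½) 0≤s+w (s+w≤1 s<½) ⟩
        1ℚ                ≤⟨ 1≤x n ⟩
        seq x n           ≤⟨ ℚ.p≤p⊔q (seq x n) 0ℚ ⟩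
        clamped x n       ∎)) (p≤∣p∣ (seq (√ x) n))
        where
        open Bisected (√-bisected x n)
        s w : ℚ
        s = seq (√ x) n
        w = width (clamped x n) n
        0≤s+w : 0ℚ ≤ s + w
        0≤s+w = +-nonNeg {s} {w} 0≤s (ℚ.<⇒≤ 0<w)
        s+w≤1 : s < ½ → s + w ≤ 1ℚ
        s+w≤1 s<½ = ℚ.<⇒≤ (ℚ.+-mono-< {s} {½} {w} {½} s<½ w<½)

  ℝ-commutativeRing : CommutativeRing 0ℓ 0ℓ
  ℝ-commutativeRing = record { isCommutativeRing = ℝ-isCommutativeRing }

  module ComplexIdentities where
    abstract
      assoc-re : ∀ a b c d e f →
        (a *ᴿ c +ᴿ -ᴿ (b *ᴿ d)) *ᴿ e +ᴿ -ᴿ ((a *ᴿ d +ᴿ b *ᴿ c) *ᴿ f)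
          ≈ᴿ a *ᴿ (c *ᴿ e +ᴿ -ᴿ (d *ᴿ f)) +ᴿ -ᴿ (b *ᴿ (c *ᴿ f +ᴿ d *ᴿ e))
      assoc-re a b c d e f = pointwise λ n → solve 6 (λ a b c d e f →
        (a :* c :- b :* d) :* e :- (a :* d :+ b :* c) :* f := a :* (c :* e :- d :* f) :- b :* (c :* f :+ d :* e))
        refl (seq a n) (seq b n) (seq c n) (seq d n) (seq e n) (seq f n)

      assoc-im : ∀ a b c d e f →
        (a *ᴿ c +ᴿ -ᴿ (b *ᴿ d)) *ᴿ f +ᴿ (a *ᴿ d +ᴿ b *ᴿ c) *ᴿ e
          ≈ᴿ a *ᴿ (c *ᴿ f +ᴿ d *ᴿ e) +ᴿ b *ᴿ (c *ᴿ e +ᴿ -ᴿ (d *ᴿ f))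
      assoc-im a b c d e f = pointwise λ n → solve 6 (λ a b c d e f →
        (a :* c :- b :* d) :* f :+ (a :* d :+ b :* c) :* e := a :* (c :* f :+ d :* e) :+ b :* (c :* e :- d :* f))
        refl (seq a n) (seq b n) (seq c n) (seq d n) (seq e n) (seq f n)

      comm-re : ∀ a b c d → a *ᴿ c +ᴿ -ᴿ (b *ᴿ d) ≈ᴿ c *ᴿ a +ᴿ -ᴿ (d *ᴿ b)
      comm-re a b c d = pointwise λ n → solve 4 (λ a b c d →
        a :* c :- b :* d := c :* a :- d :* b)
        refl (seq a n) (seq b n) (seq c n) (seq d n)

      comm-im : ∀ a b c d → a *ᴿ d +ᴿ b *ᴿ c ≈ᴿ c *ᴿ b +ᴿ d *ᴿ a
      comm-im a b c d = pointwise λ n → solve 4 (λ a b c d →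
        a :* d :+ b :* c := c :* b :+ d :* a)
        refl (seq a n) (seq b n) (seq c n) (seq d n)

      identity-re : ∀ a b → 1ᴿ *ᴿ a +ᴿ -ᴿ (0ᴿ *ᴿ b) ≈ᴿ a
      identity-re a b = pointwise λ n → solve 2 (λ a b →
        con 1ℚ :* a :- con 0ℚ :* b := a)
        refl (seq a n) (seq b n)

      identity-im : ∀ a b → 1ᴿ *ᴿ b +ᴿ 0ᴿ *ᴿ a ≈ᴿ b
      identity-im a b = pointwise λ n → solve 2 (λ a b →
        con 1ℚ :* b :+ con 0ℚ :* a := b)
        refl (seq a n) (seq b n)

      distrib-re : ∀ a b c d e f →
        a *ᴿ (c +ᴿ e) +ᴿ -ᴿ (b *ᴿ (d +ᴿ f))
          ≈ᴿ (a *ᴿ c +ᴿ -ᴿ (b *ᴿ d)) +ᴿ (a *ᴿ e +ᴿ -ᴿ (b *ᴿ f))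
      distrib-re a b c d e f = pointwise λ n → solve 6 (λ a b c d e f →
        a :* (c :+ e) :- b :* (d :+ f) := (a :* c :- b :* d) :+ (a :* e :- b :* f))
        refl (seq a n) (seq b n) (seq c n) (seq d n) (seq e n) (seq f n)

      distrib-im : ∀ a b c d e f →
        a *ᴿ (d +ᴿ f) +ᴿ b *ᴿ (c +ᴿ e)
          ≈ᴿ (a *ᴿ d +ᴿ b *ᴿ c) +ᴿ (a *ᴿ f +ᴿ b *ᴿ e)
      distrib-im a b c d e f = pointwise λ n → solve 6 (λ a b c d e f →
        a :* (d :+ f) :+ b :* (c :+ e) := (a :* d :+ b :* c) :+ (a :* f :+ b :* e))
        refl (seq a n) (seq b n) (seq c n) (seq d n) (seq e n) (seq f n)

open Reals public hiding (module ComplexIdentities)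

------------------------------------------------------------------------
-- The complex numbers

infix 5 _+i_
record ℂ : Set where
  constructor _+i_
  field
    re im : ℝ
open ℂ public

module _ where
  open CommutativeRing ℝ-commutativeRing

  infix 4 _≈ᶜ_
  record _≈ᶜ_ (z w : ℂ) : Set where
    constructor mk≈ᶜ
    field
      re≈ : re z ≈ re w
      im≈ : im z ≈ im w

  0ᶜ 1ᶜ : ℂ
  0ᶜ = 0# +i 0#
  1ᶜ = 1# +i 0#

  infixl 6 _+ᶜ_
  infixl 7 _*ᶜ_
  infix  8 -ᶜ_

  _+ᶜ_ _*ᶜ_ : ℂ → ℂ → ℂ
  (a +i b) +ᶜ (c +i d) = (a + c) +i (b + d)
  (a +i b) *ᶜ (c +i d) = (a * c - b * d) +i (a * d + b * c)

  -ᶜ_ conj : ℂ → ℂ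
  -ᶜ (a +i b) = (- a) +i (- b)
  conj (a +i b) = a +i (- b)

  fromℝ : ℝ → ℂ
  fromℝ x = x +i 0#

  ∣_∣² : ℂ → ℝ
  ∣ a +i b ∣² = a * a + b * b

  private
    module Id = Reals.ComplexIdentities

    abstract
      *ᶜ-cong : ∀ {x x′ y y′} → x ≈ᶜ x′ → y ≈ᶜ y′ → x *ᶜ y ≈ᶜ x′ *ᶜ y′
      *ᶜ-cong (mk≈ᶜ p q) (mk≈ᶜ r s) = mk≈ᶜ
        (+-cong (*-cong p r) (-‿cong (*-cong q s)))
        (+-cong (*-cong p s) (*-cong q r))

      *ᶜ-assoc : ∀ x y z → (x *ᶜ y) *ᶜ z ≈ᶜ x *ᶜ (y *ᶜ z)
      *ᶜ-assoc (a +i b) (c +i d) (e +i f) = mk≈ᶜ (Id.assoc-re a b c d e f) (Id.assoc-im a b c d e f)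

      *ᶜ-comm : ∀ x y → x *ᶜ y ≈ᶜ y *ᶜ x
      *ᶜ-comm (a +i b) (c +i d) = mk≈ᶜ (Id.comm-re a b c d) (Id.comm-im a b c d)

      *ᶜ-identityˡ : ∀ x → 1ᶜ *ᶜ x ≈ᶜ x
      *ᶜ-identityˡ (a +i b) = mk≈ᶜ (Id.identity-re a b) (Id.identity-im a b)

      *ᶜ-distribˡ : ∀ x y z → x *ᶜ (y +ᶜ z) ≈ᶜ (x *ᶜ y) +ᶜ (x *ᶜ z)
      *ᶜ-distribˡ (a +i b) (c +i d) (e +i f) =
        mk≈ᶜ (Id.distrib-re a b c d e f) (Id.distrib-im a b c d e f)

      ≈ᶜ-trans : ∀ {x y z} → x ≈ᶜ y → y ≈ᶜ z → x ≈ᶜ z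
      ≈ᶜ-trans (mk≈ᶜ p q) (mk≈ᶜ r s) = mk≈ᶜ (trans p r) (trans q s)

      +ᶜ-cong : ∀ {x x′ y y′} → x ≈ᶜ x′ → y ≈ᶜ y′ → x +ᶜ y ≈ᶜ x′ +ᶜ y′
      +ᶜ-cong (mk≈ᶜ p q) (mk≈ᶜ r s) = mk≈ᶜ (+-cong p r) (+-cong q s)

  ℂ-isCommutativeRing : IsCommutativeRing _≈ᶜ_ _+ᶜ_ _*ᶜ_ -ᶜ_ 0ᶜ 1ᶜ
  ℂ-isCommutativeRing = record
    { isRing = record
      { +-isAbelianGroup = record
        { isGroup = record
          { isMonoid = record
            { isSemigroup = record
              { isMagma = record
                { isEquivalence = record
                  { refl  = mk≈ᶜ refl refl
                  ; sym   = λ (mk≈ᶜ p q) → mk≈ᶜ (sym p) (sym q)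
                  ; trans = ≈ᶜ-trans
                  }
                ; ∙-cong = +ᶜ-cong
                }
              ; assoc = λ x y z → mk≈ᶜ (+-assoc (re x) (re y) (re z)) (+-assoc (im x) (im y) (im z))
              }
            ; identity = (λ x → mk≈ᶜ (+-identityˡ (re x)) (+-identityˡ (im x)))
                       , (λ x → mk≈ᶜ (+-identityʳ (re x)) (+-identityʳ (im x)))
            }
          ; inverse = (λ x → mk≈ᶜ (-‿inverseˡ (re x)) (-‿inverseˡ (im x)))
                    , (λ x → mk≈ᶜ (-‿inverseʳ (re x)) (-‿inverseʳ (im x)))
          ; ⁻¹-cong = λ (mk≈ᶜ p q) → mk≈ᶜ (-‿cong p) (-‿cong q)
          }
        ; comm = λ x y → mk≈ᶜ (+-comm (re x) (re y)) (+-comm (im x) (im y))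
        }
      ; *-cong = *ᶜ-cong
      ; *-assoc = *ᶜ-assoc
      ; *-identity = *ᶜ-identityˡ , (λ x → ≈ᶜ-trans (*ᶜ-comm x 1ᶜ) (*ᶜ-identityˡ x))
      ; distrib = *ᶜ-distribˡ , λ x y z →
          ≈ᶜ-trans (*ᶜ-comm (y +ᶜ z) x) (≈ᶜ-trans (*ᶜ-distribˡ x y z) (+ᶜ-cong (*ᶜ-comm x y) (*ᶜ-comm x z)))
      }
    ; *-comm = *ᶜ-comm
    }

ℂ-commutativeRing : CommutativeRing 0ℓ 0ℓ
ℂ-commutativeRing = record { isCommutativeRing = ℂ-isCommutativeRing }

------------------------------------------------------------------------
-- Complex vectors and matrices

open CommutativeRing ℂ-commutativeRing using (_≈_; _*_; 0#; 1#)
open CommutativeMonoidSum (CommutativeRing.+-commutativeMonoid ℂ-commutativeRing) using (sum-syntax)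
module ℝ-sum = CommutativeMonoidSum (CommutativeRing.+-commutativeMonoid ℝ-commutativeRing)

Matrix : ℕ → ℕ → Set
Matrix m n = Fin m → Fin n → ℂ

infix 4 _≋_
_≋_ : ∀ {m n} → Matrix m n → Matrix m n → Set
A ≋ B = ∀ i j → A i j ≈ B i j

identity : ∀ {n} → Matrix n n
identity i j = if does (i Fin.≟ j) then 1# else 0#

infixl 7 _·_
_·_ : ∀ {l m n} → Matrix l m → Matrix m n → Matrix l n
_·_ {m = m} A B i k = ∑[ j < m ] (A i j * B j k)

infix 9 _ᵀ
_ᵀ : ∀ {m n} → Matrix m n → Matrix n m
(A ᵀ) i j = A j i

infixr 8 _^_
_^_ : ∀ {n} → Matrix n n → ℕ → Matrix n n
A ^ zero  = identity
A ^ suc k = A · (A ^ k)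

infixl 7 _·ᵥ_
_·ᵥ_ : ∀ {m n} → Matrix m n → Vector ℂ n → Vector ℂ m
_·ᵥ_ {n = n} A v i = ∑[ j < n ] (A i j * v j)

⟨_,_⟩ : ∀ {n} → Vector ℂ n → Vector ℂ n → ℂ
⟨_,_⟩ {n} v w = ∑[ i < n ] (conj (v i) * w i)

∥_∥₂ : ∀ {n} → Vector ℂ n → ℝ
∥ v ∥₂ = √ (ℝ-sum.sum λ i → ∣ v i ∣²)

1ᵥ : ∀ {n} → Vector ℂ n
1ᵥ _ = 1#

abstract
  ∥1ᵥ∥₂#0 : ∀ N .{{_ : NonZero N}} → ∥ 1ᵥ {N} ∥₂ #0
  ∥1ᵥ∥₂#0 (suc n) = √-apart (ℝ-sum.sum {suc n} λ _ → ∣ 1# ∣²) (1≤ n)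
    where
    open import Data.Rational.Base using (ℚ; 0ℚ; 1ℚ; _≤_)
    0≤ : ∀ n k → 0ℚ ≤ seq (ℝ-sum.sum {n} λ _ → ∣ 1# ∣²) k
    0≤ zero    k = ℚ.≤-refl
    0≤ (suc n) k = ℚ.+-mono-≤ {0ℚ} {1ℚ} {0ℚ} (ℚ.nonNegative⁻¹ 1ℚ) (0≤ n k)
    1≤ : ∀ n k → 1ℚ ≤ seq (ℝ-sum.sum {suc n} λ _ → ∣ 1# ∣²) k
    1≤ n k = ℚ.+-mono-≤ {1ℚ} {1ℚ} {0ℚ} ℚ.≤-refl (0≤ n k)

e : ∀ {N} .{{_ : NonZero N}} → Vector ℂ N
e {N} i = fromℝ (inv ∥ 1ᵥ {N} ∥₂ (∥1ᵥ∥₂#0 N)) * 1ᵥ {N} i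

φₑ : ∀ {N} .{{_ : NonZero N}} → Matrix N N → ℂ
φₑ B = ⟨ e , B ·ᵥ e ⟩

momentMatrix : ∀ {N} .{{_ : NonZero N}} (m : ℕ) → Matrix N N → Matrix (suc m) (suc m)
momentMatrix m A i j = φₑ (A ^ (toℕ i ℕ.+ toℕ j))

IsPermutationMatrix : ∀ {N} → Matrix N N → Set
IsPermutationMatrix P =
  (∀ i j → P i j ≈ 0# ⊎ P i j ≈ 1#) ×
  (∀ i → ∃! _≡_ λ j → P i j ≈ 1#) ×
  (∀ j → ∃! _≡_ λ i → P i j ≈ 1#)

------------------------------------------------------------------------
-- Graphs

record Graph (N : ℕ) : Set₁ where
  field
    Adj     : Rel (Fin N) 0ℓ
    adj?    : Decidable Adj
    symm    : Symmetric Adj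
    irrefl  : Irreflexive _≡_ Adj

-- An adjacency matrix depends on an ordering σ of the vertices.
_IsAdjacencyMatrixOf_ : ∀ {N} → Matrix N N → Graph N → Set
_IsAdjacencyMatrixOf_ {N} A G = Σ[ σ ∈ Permutation′ N ] ∀ i j →
  (A i j ≈ 0# ⊎ A i j ≈ 1#) ×
  (A i j ≈ 1# ⇔ Adj (σ ⟨$⟩ʳ i) (σ ⟨$⟩ʳ j))
  where open Graph G

{-# OPTIONS --safe #-}

-- A permutation matrix P with ones at the positions (i , π i) satisfies
-- (P B Pᵀ)(i , j) = B (π i , π j), so conjugation by P is a simultaneous
-- reindexing of rows and columns. Reindexing commutes with powers, and it
-- preserves φₑ because e is constant and sums do not depend on the order of
-- their terms.

module Submission where

open import Defs
open import Algebra.Bundles using (CommutativeRing)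
import Algebra.Properties.CommutativeMonoid.Sum as CommutativeMonoidSum
open import Data.Bool.Base using (if_then_else_)
open import Data.Fin.Base using (Fin; toℕ; punchIn)
open import Data.Fin.Permutation using (Permutation′; permutation; _⟨$⟩ʳ_)
open import Data.Fin.Properties using (_≟_; punchInᵢ≢i)
open import Data.Nat.Base using (ℕ; zero; suc; NonZero; _+_)
open import Data.Product.Base using (∃; _,_; proj₁; proj₂)
open import Data.Sum.Base using (inj₁; inj₂)
open import Data.Vec.Functional using (Vector; removeAt)
open import Function.Base using (_∘_)
open import Function.Bundles using (Injection; mk⇔)
open import Function.Properties.Inverse using (Inverse⇒Injection)
open import Relation.Binary.PropositionalEquality as ≡ using (_≡_)
open import Relation.Nullary.Decidable using (yes; no; dec-true; dec-false; does-⇔)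
open import Relation.Nullary.Negation using (contradiction)

open CommutativeRing ℂ-commutativeRing
  using (_≈_; _*_; 0#; 1#; +-cong; *-cong; *-congˡ; *-congʳ; *-comm; *-identityˡ;
         zeroˡ; +-identityʳ; sym; trans; reflexive; setoid; +-commutativeMonoid)
open CommutativeMonoidSum +-commutativeMonoid
  using (sum; sum-cong-≋; sum-remove; sum-permute; sum-replicate-zero)
open import Relation.Binary.Reasoning.Setoid setoid

private
  variable
    l m n : ℕ

identity-diagonal : (i : Fin n) → identity i i ≡ 1#
identity-diagonal i = ≡.cong (if_then 1# else 0#) (dec-true (i ≟ i) ≡.refl)

identity-off-diagonal : {i j : Fin n} → i ≡.≢ j → identity i j ≡ 0#
identity-off-diagonal {i = i} {j} i≢j = ≡.cong (if_then 1# else 0#) (dec-false (i ≟ j) i≢j)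

-- Splitting off the `i`-th term of the sum leaves only zeros. The index `i` rules out size zero, so
-- matching on `suc n` alone is exhaustive.
identity-·ᵥ : (v : Vector ℂ n) (i : Fin n) → (identity ·ᵥ v) i ≈ v i
identity-·ᵥ {suc n} v i = begin
  sum t                      ≈⟨ sum-remove {i = i} t ⟩
  t i +ᶜ sum (removeAt t i)  ≈⟨ +-cong head rest ⟩
  v i +ᶜ 0#                  ≈⟨ +-identityʳ (v i) ⟩
  v i                        ∎
  where
  t : Vector ℂ (suc n)
  t j = identity i j * v j
  head : t i ≈ v i
  head = trans (*-congʳ (reflexive (identity-diagonal i))) (*-identityˡ (v i))
  rest : sum (removeAt t i) ≈ 0#
  rest = trans
    (sum-cong-≋ λ j → trans
      (*-congʳ (reflexive (identity-off-diagonal (punchInᵢ≢i i j ∘ ≡.sym))))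
      (zeroˡ (v (punchIn i j))))
    (sum-replicate-zero n)

reindex : Permutation′ n → Matrix n n → Matrix n n
reindex π A i j = A (π ⟨$⟩ʳ i) (π ⟨$⟩ʳ j)

·-cong : {A A′ : Matrix l m} {B B′ : Matrix m n} → A ≋ A′ → B ≋ B′ → A · B ≋ A′ · B′
·-cong A≋A′ B≋B′ i k = sum-cong-≋ λ j → *-cong (A≋A′ i j) (B≋B′ j k)

-- Injectivity of `π` is what matters: `i ≡ j` and `π i ≡ π j` are equivalent, so both decisions
-- give the same boolean.
reindex-identity : (π : Permutation′ n) → identity ≋ reindex π identity
reindex-identity π i j = reflexive (≡.cong (if_then 1# else 0#)
  (does-⇔ (mk⇔ (≡.cong (π ⟨$⟩ʳ_)) (Injection.injective (Inverse⇒Injection π)))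
    (i ≟ j) ((π ⟨$⟩ʳ i) ≟ (π ⟨$⟩ʳ j))))

-- The summation index `j` of the left side runs through `π j`, a reordering of the sum on the
-- right.
reindex-· : (π : Permutation′ n) (A B : Matrix n n) →
            reindex π A · reindex π B ≋ reindex π (A · B)
reindex-· π A B i k = sym (sum-permute (λ j → A (π ⟨$⟩ʳ i) j * B j (π ⟨$⟩ʳ k)) π)

-- Stated for any `B` pointwise equal to the reindexed matrix, because `P · A · P ᵀ` is such a
-- matrix only up to `≋`.
reindex-^ : (π : Permutation′ n) {A B : Matrix n n} → B ≋ reindex π A →
            ∀ k → B ^ k ≋ reindex π (A ^ k)
reindex-^ π     B≋πA zero    i j = reindex-identity π i j
reindex-^ π {A} B≋πA (suc k) i j =
  trans (·-cong B≋πA (reindex-^ π B≋πA k) i j) (reindex-· π A (A ^ k) i j)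

φₑ-reindex : .{{_ : NonZero n}} (π : Permutation′ n) {A B : Matrix n n} →
             B ≋ reindex π A → φₑ B ≈ φₑ A
φₑ-reindex π {A} {B} B≋πA = begin
  φₑ B                                          ≈⟨ sum-cong-≋ (λ i → *-congˡ (row i)) ⟩
  -- Since `e` is constant, `e i` and `e (π i)` are definitionally equal, so permuting the sum needs
  -- no rewriting of this factor. The same happens with `e j` in `row`.
  sum (λ i → conj (e i) * (A ·ᵥ e) (π ⟨$⟩ʳ i))  ≈⟨ sum-permute (λ i → conj (e i) * (A ·ᵥ e) i) π ⟨
  φₑ A                                          ∎
  where
  row : ∀ i → (B ·ᵥ e) i ≈ (A ·ᵥ e) (π ⟨$⟩ʳ i)
  row i = begin
    sum (λ j → B i j * e j)            ≈⟨ sum-cong-≋ (λ j → *-congʳ {e j} (B≋πA i j)) ⟩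
    sum (λ j → reindex π A i j * e j)  ≈⟨ sum-permute (λ j → A (π ⟨$⟩ʳ i) j * e j) π ⟨
    (A ·ᵥ e) (π ⟨$⟩ʳ i)                ∎

-- `π` sends a row to the column of its one; the inverse sends a column to the row of its one.
-- Uniqueness within rows and within columns makes the two maps mutually inverse.
permutation-of : {P : Matrix n n} → IsPermutationMatrix P →
                 ∃ λ (π : Permutation′ n) → ∀ i j → P i j ≈ identity (π ⟨$⟩ʳ i) j
permutation-of {n} {P} (P∈01 , rows , cols) = permutation to from to∘from from∘to , entry
  where
  to from : Fin n → Fin n
  to i = proj₁ (rows i)
  from j = proj₁ (cols j)
  to∘from : ∀ j → to (from j) ≡ j
  to∘from j = proj₂ (proj₂ (rows (from j))) (proj₁ (proj₂ (cols j)))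
  from∘to : ∀ i → from (to i) ≡ i
  from∘to i = proj₂ (proj₂ (cols (to i))) (proj₁ (proj₂ (rows i)))
  entry : ∀ i j → P i j ≈ identity (to i) j
  entry i j with to i ≟ j | P∈01 i j
  ... | yes ≡.refl | _          = proj₁ (proj₂ (rows i))
  ... | no  _      | inj₁ Pij≈0 = Pij≈0
  -- A second one in row `i` would contradict uniqueness.
  ... | no  to≢j   | inj₂ Pij≈1 = contradiction (proj₂ (proj₂ (rows i)) Pij≈1) to≢j

-- Row `i` of `P` is row `π i` of the identity.
permutation-·ᵥ : (π : Permutation′ n) {P : Matrix n n} →
                 (∀ i j → P i j ≈ identity (π ⟨$⟩ʳ i) j) →
                 (v : Vector ℂ n) (i : Fin n) → (P ·ᵥ v) i ≈ v (π ⟨$⟩ʳ i)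
permutation-·ᵥ π {P} P≈π v i = trans
  (sum-cong-≋ λ j → *-congʳ {v j} (P≈π i j))
  (identity-·ᵥ v (π ⟨$⟩ʳ i))

conjugate≋reindex : (π : Permutation′ n) {P : Matrix n n} →
                    (∀ i j → P i j ≈ identity (π ⟨$⟩ʳ i) j) →
                    (A : Matrix n n) → P · A · P ᵀ ≋ reindex π A
conjugate≋reindex π {P} P≈π A i k = begin
  -- With the factors swapped, the product with `P ᵀ` becomes `P` acting on row `i` of `P · A`. This
  -- selects column `π k`, and the remaining `P` then selects row `π i`.
  (P · A · P ᵀ) i k                ≈⟨ sum-cong-≋ (λ j → *-comm ((P · A) i j) (P k j)) ⟩
  (P ·ᵥ (λ j → (P · A) i j)) k     ≈⟨ permutation-·ᵥ π P≈π (λ j → (P · A) i j) k ⟩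
  (P ·ᵥ (λ l → A l (π ⟨$⟩ʳ k))) i  ≈⟨ permutation-·ᵥ π P≈π (λ l → A l (π ⟨$⟩ʳ k)) i ⟩
  reindex π A i k                  ∎

theorem3p15 : (N : ℕ) .{{_ : NonZero N}} (G : Graph N) (m : ℕ) (A P : Matrix N N) →
    A IsAdjacencyMatrixOf G → IsPermutationMatrix P →
    momentMatrix m (P · A · P ᵀ) ≋ momentMatrix m A
theorem3p15 N G m A P _ P-perm i j =
  let π , P≈π = permutation-of P-perm
  in φₑ-reindex π (reindex-^ π (conjugate≋reindex π P≈π A) (toℕ i + toℕ j))
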